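{- Let $k\ge 0$ be an integer. As formal power series, $$\sum_{n\geq 0} F_{n-k}^n x^n = \frac{k!\cdot x^{2k}}{\left(\prod_{i=1}^k (1-ix)\right)^2\cdot(1-(k+1)x)},$$ where $F_{n-k}^n$ is the number of maximal rook placements with exactly $n-k$ rooks on the triangular board $\Psi_{1,\ldots,1}$ of size $n$.
   Context: The triangular board $\Psi_{1,\ldots,1}$ of size $n$ is the set of squares $\{(i,j): 1\le i\le j\le n\}$, where $i$ is the column and $j$ is the row. A rook placement is a set of squares, no two in the same row and no two in the same column; it is maximal if no further square of the board can be added to it so that it remains a rook placement. Conventions: the board of size $0$ is empty (its only rook placement, the empty one, is maximal, so $F_0^0=1$), and $F^n_{n-k}=0$ if $n<k$. -}

module Defs where

open import Data.Fin.Base as Fin using (Fin; toℕ)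
open import Data.Integer as ℤ using (ℤ; +_; 0ℤ; 1ℤ)
import Data.Integer.Properties as ℤ
open import Data.List.Base
  using (List; []; _∷_; _++_; map; concatMap; downFrom; filter; length)
open import Data.List.Membership.Propositional using (_∈_; _∉_)
open import Data.List.Membership.Propositional.Properties
  using (∈-map⁺; ∈-map⁻; ∈-++⁻; ∈-++⁺ˡ; ∈-++⁺ʳ; ∈-downFrom⁺; ∈-downFrom⁻)
open import Data.List.Relation.Unary.All as All using (All)
open import Data.List.Relation.Unary.AllPairs as AllPairs using (AllPairs)
open import Data.List.Relation.Unary.AllPairs using ([])
open import Data.List.Relation.Unary.Unique.Propositional using (Unique)
import Data.List.Relation.Unary.Unique.Propositional.Properties as Unique
open import Data.Nat as ℕ using (ℕ; zero; suc; _∸_; _≤_; z≤n; s≤s)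
import Data.Nat.Properties as ℕ
open import Data.Product using (_×_; _,_; proj₁; proj₂)
open import Data.Product.Properties using (≡-dec)
open import Data.Sum using (inj₁; inj₂)
open import Data.Vec.Functional as Vector using (Vector)
open import Function.Base using (_∘_; const)
open import Function.Bundles using (_⇔_; mk⇔)
open import Relation.Binary.PropositionalEquality
open import Relation.Nullary using (¬_; Dec; ¬?; _×-dec_; _→-dec_)
open import Relation.Unary using (Decidable)

open import Algebra.Properties.CommutativeMonoid.Sum ℤ.+-0-commutativeMonoid
  using (sum; sum⁺-syntax; sum-cong-≗)

-- (column , row)
Square : Set
Square = ℕ × ℕ

col row : Square → ℕ
col = proj₁
row = proj₂

boardRow : ℕ → List Square
boardRow j = map (λ i → suc i , j) (downFrom j)

-- Listed row by row from row n down to row 1, so that board (suc n) is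
-- definitionally boardRow (suc n) ++ board n.  ∈-board and board-unique
-- below show that this lists each (i , j) with 1 ≤ i ≤ j ≤ n exactly once.
board : ℕ → List Square
board n = concatMap (boardRow ∘ suc) (downFrom n)

-- On a duplicate-free list this enumerates each subset exactly once.
sublists : ∀ {a} {A : Set a} → List A → List (List A)
sublists []       = [] ∷ []
sublists (x ∷ xs) = map (x ∷_) (sublists xs) ++ sublists xs

NonAttacking : Square → Square → Set
NonAttacking s t = col s ≢ col t × row s ≢ row t

RookPlacement : List Square → Set
RookPlacement = AllPairs NonAttacking

Maximal : ℕ → List Square → Set
Maximal n p =
  RookPlacement p × All (λ s → s ∉ p → ¬ RookPlacement (s ∷ p)) (board n)

_≟_ : (s t : Square) → Dec (s ≡ t)
_≟_ = ≡-dec ℕ._≟_ ℕ._≟_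

open import Data.List.Membership.DecPropositional _≟_ using (_∉?_)

nonAttacking? : ∀ s t → Dec (NonAttacking s t)
nonAttacking? s t = ¬? (col s ℕ.≟ col t) ×-dec ¬? (row s ℕ.≟ row t)

rookPlacement? : Decidable RookPlacement
rookPlacement? = AllPairs.allPairs? nonAttacking?

maximal? : ∀ n → Decidable (Maximal n)
maximal? n p = rookPlacement? p ×-dec
  All.all? (λ s → (s ∉? p) →-dec ¬? (rookPlacement? (s ∷ p))) (board n)

-- F n r is the number of maximal rook placements with exactly r rooks on the
-- board of size n.  The index r is an integer, so that F n (+ n - + k) makes
-- sense, and vanishes, also for n < k.
F : ℕ → ℤ → ℕ
F n r = length
  (filter (λ p → maximal? n p ×-dec (+ length p ℤ.≟ r)) (sublists (board n)))

-- Formal power series with integer coefficients: f n is the coefficient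
-- of xⁿ.

Series : Set
Series = ℕ → ℤ

infix  4 _≈_
infixl 6 _-_
infixl 7 _*_ _/_
infixr 8 _^_

_≈_ : Series → Series → Set
f ≈ g = ∀ n → f n ≡ g n

constant : ℤ → Series
constant c zero    = c
constant c (suc _) = 0ℤ

𝟙 : Series
𝟙 = constant 1ℤ

x : Series
x 1 = 1ℤ
x _ = 0ℤ

_-_ : Series → Series → Series
(f - g) n = f n ℤ.- g n

_*_ : Series → Series → Series
(f * g) n = ∑[ i ≤ n ] (f (toℕ i) ℤ.* g (n ∸ toℕ i))

_^_ : Series → ℕ → Series
f ^ zero  = 𝟙
f ^ suc n = f * f ^ n

∏ : ℕ → (ℕ → Series) → Series
∏ zero    f = 𝟙
∏ (suc k) f = ∏ k f * f (suc k)

infix 5 ∏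
syntax ∏ k (λ i → f) = ∏[1≤ i ≤ k ] f

-- The coefficients n, n - 1, …, 0 of the inverse h of a series g with
-- constant coefficient 1, from the recursion
-- h₀ = 1,  hₙ₊₁ = - (g₁ hₙ + g₂ hₙ₋₁ + ⋯ + gₙ₊₁ h₀).
inverseCoeffs : Series → ∀ n → Vector ℤ (suc n)
inverseCoeffs g zero    = const 1ℤ
inverseCoeffs g (suc n) =
  (ℤ.- (∑[ i ≤ n ] (g (suc (toℕ i)) ℤ.* hs i))) Vector.∷ hs
  where hs = inverseCoeffs g n

-- Meaningful only for constant coefficient 1; see *-inverse and
-- denominator-const≡1.
_⁻¹ : Series → Series
(g ⁻¹) n = inverseCoeffs g n Fin.zero

_/_ : Series → Series → Series
f / g = f * g ⁻¹

∈-boardRow : ∀ {i j m} → (i , j) ∈ boardRow m ⇔ (1 ≤ i × i ≤ m × j ≡ m)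
∈-boardRow {m = m} = mk⇔ to from
  where
  to : ∀ {i j} → (i , j) ∈ boardRow m → 1 ≤ i × i ≤ m × j ≡ m
  to p with _ , q , refl ← ∈-map⁻ _ p = s≤s z≤n , ∈-downFrom⁻ q , refl
  from : ∀ {i j} → 1 ≤ i × i ≤ m × j ≡ m → (i , j) ∈ boardRow m
  from {suc i} (_ , i≤m , refl) = ∈-map⁺ _ (∈-downFrom⁺ i≤m)

∈-board : ∀ n {i j} → (i , j) ∈ board n ⇔ (1 ≤ i × i ≤ j × j ≤ n)
∈-board n = mk⇔ (to n) (from n)
  where
  open Function.Bundles.Equivalence using () renaming (to to ⇒; from to ⇐)
  to : ∀ n {i j} → (i , j) ∈ board n → 1 ≤ i × i ≤ j × j ≤ n
  to (suc n) p with ∈-++⁻ (boardRow (suc n)) p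
  ... | inj₁ q with 1≤i , i≤j , refl ← ⇒ (∈-boardRow {m = suc n}) q =
    1≤i , i≤j , ℕ.≤-refl
  ... | inj₂ q with 1≤i , i≤j , j≤n ← to n q =
    1≤i , i≤j , ℕ.m≤n⇒m≤1+n j≤n
  from : ∀ n {i j} → 1 ≤ i × i ≤ j × j ≤ n → (i , j) ∈ board n
  from zero    (s≤s _ , () , z≤n)
  from (suc n) (1≤i , i≤j , j≤1+n) with ℕ.m≤n⇒m<n∨m≡n j≤1+n
  ... | inj₁ (s≤s j≤n) =
    ∈-++⁺ʳ (boardRow (suc n)) (from n (1≤i , i≤j , j≤n))
  ... | inj₂ refl = ∈-++⁺ˡ (⇐ ∈-boardRow (1≤i , i≤j , refl))

board-unique : ∀ n → Unique (board n)
board-unique zero    = []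
board-unique (suc n) = Unique.++⁺
  (Unique.map⁺ (ℕ.suc-injective ∘ cong proj₁) (Unique.downFrom⁺ (suc n)))
  (board-unique n)
  λ (p , q) → disjoint p q
  where
  open Function.Bundles.Equivalence using (to)
  disjoint : ∀ {s} → s ∈ boardRow (suc n) → ¬ s ∈ board n
  disjoint p q with _ , _ , refl ← to (∈-boardRow {m = suc n}) p
                  | _ , _ , j≤n  ← to (∈-board n) q = ℕ.1+n≰n j≤n

inverseCoeffs-⁻¹ : ∀ g n (i : Fin (suc n)) →
                   inverseCoeffs g n i ≡ (g ⁻¹) (n ∸ toℕ i)
inverseCoeffs-⁻¹ g zero    Fin.zero    = refl
inverseCoeffs-⁻¹ g (suc n) Fin.zero    = refl
inverseCoeffs-⁻¹ g (suc n) (Fin.suc i) = inverseCoeffs-⁻¹ g n i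

*-inverse : ∀ g → g 0 ≡ 1ℤ → g * g ⁻¹ ≈ 𝟙
*-inverse g g₀≡1 zero = begin
  g 0 ℤ.* 1ℤ ℤ.+ 0ℤ ≡⟨ cong (λ c → c ℤ.* 1ℤ ℤ.+ 0ℤ) g₀≡1 ⟩
  1ℤ                ∎
  where open ≡-Reasoning
*-inverse g g₀≡1 (suc n) = begin
  g 0 ℤ.* (ℤ.- S) ℤ.+ ∑[ i ≤ n ] (g (suc (toℕ i)) ℤ.* (g ⁻¹) (n ∸ toℕ i))
    ≡⟨ cong₂ ℤ._+_
         (trans (cong (ℤ._* (ℤ.- S)) g₀≡1) (ℤ.*-identityˡ (ℤ.- S)))
         (sum-cong-≗ λ i →
           cong (g (suc (toℕ i)) ℤ.*_) (sym (inverseCoeffs-⁻¹ g n i))) ⟩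
  ℤ.- S ℤ.+ S
    ≡⟨ ℤ.+-inverseˡ S ⟩
  0ℤ ∎
  where
  open ≡-Reasoning
  S : ℤ
  S = ∑[ i ≤ n ] (g (suc (toℕ i)) ℤ.* inverseCoeffs g n i)

*-const≡1 : ∀ f g → f 0 ≡ 1ℤ → g 0 ≡ 1ℤ → (f * g) 0 ≡ 1ℤ
*-const≡1 f g p q = cong₂ (λ a b → a ℤ.* b ℤ.+ 0ℤ) p q

linear-const≡1 : ∀ c → (𝟙 - constant c * x) 0 ≡ 1ℤ
linear-const≡1 c =
  cong (λ a → 1ℤ ℤ.- (a ℤ.+ 0ℤ)) (ℤ.*-zeroʳ c)

∏-const≡1 : ∀ k f → (∀ i → f i 0 ≡ 1ℤ) → ∏ k f 0 ≡ 1ℤ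
∏-const≡1 zero    f p = refl
∏-const≡1 (suc k) f p = *-const≡1 (∏ k f) (f (suc k)) (∏-const≡1 k f p) (p (suc k))

denominator-const≡1 : ∀ k →
  ((∏[1≤ i ≤ k ] (𝟙 - constant (+ i) * x)) ^ 2 * (𝟙 - constant (+ suc k) * x)) 0
    ≡ 1ℤ
denominator-const≡1 k = *-const≡1 (P ^ 2) L P²₀ (linear-const≡1 (+ suc k))
  where
  P L : Series
  P = ∏[1≤ i ≤ k ] (𝟙 - constant (+ i) * x)
  L = 𝟙 - constant (+ suc k) * x
  P₀ : P 0 ≡ 1ℤ
  P₀ = ∏-const≡1 k _ (linear-const≡1 ∘ +_)
  P²₀ : (P ^ 2) 0 ≡ 1ℤ
  P²₀ = *-const≡1 P (P ^ 1) P₀ (*-const≡1 P 𝟙 P₀ refl)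

{-# OPTIONS --safe #-}

-- Build a placement row by row from below.  With n rows and n columns in play,
-- call a free column pending if some free row lies at or above its lowest
-- square, and optional otherwise.  A placement is maximal iff it has no pending
-- column, and it then leaves k rows free iff it has k optional columns.  When
-- column and row n + 1 are added to a placement with b pending and g optional
-- columns, leaving the row free makes all b + g + 1 free columns pending;
-- otherwise its rook goes into one of b pending columns, giving (b - 1 , g + 1),
-- or into one of g + 1 optional ones, giving (b , g) again.  So the number of
-- placements with given (b , g) obeys a linear recurrence in n, and each
-- recurrence f(n+1) = c f(n) + h(n+1) reads f (1 - c x) = h for the generating
-- series.
module Submission where

open import Algebra.Bundles using (CommutativeMonoid)
import Data.Integer as ℤ
import Data.Integer.Properties as ℤ
import Data.Integer.Tactic.RingSolver as ℤ
open import Data.List.Base using (List; []; _∷_; _++_; map; downFrom; filter; length)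
open import Data.List.Membership.Propositional using (_∈_; find; lose)
open import Data.List.Membership.Propositional.Properties
  using (∈-map⁺; ∈-map⁻; ∈-downFrom⁺; ∈-downFrom⁻)
open import Data.List.Properties using (map-∘)
open import Data.List.Relation.Unary.All as All using (All; []; _∷_)
import Data.List.Relation.Unary.All.Properties as All
open import Data.List.Relation.Unary.AllPairs using ([]; _∷_)
open import Data.List.Relation.Unary.Any as Any using (Any; here; there)
open import Data.List.Relation.Unary.Unique.Propositional using (Unique)
import Data.List.Relation.Unary.Unique.Propositional.Properties as Unique
open import Data.Bool.Base using (true; false; if_then_else_)
open import Data.Nat as ℕ using (ℕ; zero; suc; pred; _≤_; z≤n; s≤s; _!)
open import Data.Nat.ListAction using (sum)
import Data.Nat.Properties as ℕ
open import Data.Product using (_×_; _,_; proj₁; proj₂)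
open import Function.Base using (_∘_; case_of_)
open import Function.Bundles using (_⇔_; mk⇔; Equivalence)
import Relation.Binary.Reasoning.Setoid as SetoidReasoning
open import Relation.Binary.PropositionalEquality
open import Relation.Nullary using (¬_; Dec; yes; no; does; ¬?; _×-dec_; contradiction)
open import Relation.Unary using (Decidable)

module RookCount where

  open import Defs hiding (_*_; x)
  open import Data.Nat using (_+_; _*_)
  open import Data.Nat.Tactic.RingSolver using (solve-∀)
  open ≡-Reasoning
  open Equivalence using (to; from)

  private variable
    X Y : Set

  -- Indicators of decidable propositions

  ⟦_⟧ : {P : Set} → Dec P → ℕ
  ⟦ P? ⟧ = if does P? then 1 else 0

  ⟦⟧-yes : {P : Set} (P? : Dec P) → P → ⟦ P? ⟧ ≡ 1
  ⟦⟧-yes (yes _) _ = refl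
  ⟦⟧-yes (no ¬p) p = contradiction p ¬p

  ⟦⟧-no : {P : Set} (P? : Dec P) → ¬ P → ⟦ P? ⟧ ≡ 0
  ⟦⟧-no (yes p) ¬p = contradiction p ¬p
  ⟦⟧-no (no _)  _  = refl

  ⟦⟧-cong : {P Q : Set} (P? : Dec P) (Q? : Dec Q) → P ⇔ Q → ⟦ P? ⟧ ≡ ⟦ Q? ⟧
  ⟦⟧-cong P? (yes q) e = ⟦⟧-yes P? (from e q)
  ⟦⟧-cong P? (no ¬q) e = ⟦⟧-no P? (¬q ∘ to e)

  ⟦⟧-partition : {P Q : Set} (P? : Dec P) (Q? : Dec Q) →
    ⟦ P? ⟧ ≡ ⟦ P? ×-dec Q? ⟧ + ⟦ P? ×-dec ¬? Q? ⟧
  ⟦⟧-partition (yes _) (yes _) = refl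
  ⟦⟧-partition (yes _) (no _)  = refl
  ⟦⟧-partition (no _)  _       = refl

  ⟦⟧-× : {P Q : Set} (P? : Dec P) (Q? : Dec Q) → ⟦ P? ×-dec Q? ⟧ ≡ ⟦ P? ⟧ * ⟦ Q? ⟧
  ⟦⟧-× (yes _) Q? = sym (ℕ.+-identityʳ ⟦ Q? ⟧)
  ⟦⟧-× (no _)  Q? = refl

  -- Finite sums over lists

  ∑ : List X → (X → ℕ) → ℕ
  ∑ xs f = sum (map f xs)

  ∑-cong-All : ∀ {f g : X → ℕ} {xs} → All (λ x → f x ≡ g x) xs → ∑ xs f ≡ ∑ xs g
  ∑-cong-All []       = refl
  ∑-cong-All (p ∷ ps) = cong₂ _+_ p (∑-cong-All ps)

  ∑-cong : ∀ {f g : X → ℕ} xs → (∀ {x} → x ∈ xs → f x ≡ g x) → ∑ xs f ≡ ∑ xs g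
  ∑-cong xs p = ∑-cong-All (All.tabulate p)

  ∑-zero : ∀ {f : X → ℕ} xs → (∀ {x} → x ∈ xs → f x ≡ 0) → ∑ xs f ≡ 0
  ∑-zero []       p = refl
  ∑-zero (x ∷ xs) p = cong₂ _+_ (p (here refl)) (∑-zero xs (p ∘ there))

  ∑-zero⁻ : ∀ {f : X → ℕ} xs → ∑ xs f ≡ 0 → ∀ {x} → x ∈ xs → f x ≡ 0
  ∑-zero⁻ {f = f} (x ∷ xs) p (here refl) = ℕ.m+n≡0⇒m≡0 (f x) p
  ∑-zero⁻ {f = f} (x ∷ xs) p (there q)   = ∑-zero⁻ xs (ℕ.m+n≡0⇒n≡0 (f x) p) q

  ∑-++ : ∀ (f : X → ℕ) xs ys → ∑ (xs ++ ys) f ≡ ∑ xs f + ∑ ys f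
  ∑-++ f []       ys = refl
  ∑-++ f (x ∷ xs) ys = trans (cong (f x +_) (∑-++ f xs ys)) (sym (ℕ.+-assoc (f x) _ _))

  ∑-map : ∀ (f : Y → ℕ) (h : X → Y) xs → ∑ (map h xs) f ≡ ∑ xs (f ∘ h)
  ∑-map f h xs = cong sum (sym (map-∘ xs))

  ∑-+ : ∀ (f g : X → ℕ) xs → ∑ xs (λ x → f x + g x) ≡ ∑ xs f + ∑ xs g
  ∑-+ f g []       = refl
  ∑-+ f g (x ∷ xs) rewrite ∑-+ f g xs = lemma (f x) (g x) (∑ xs f) (∑ xs g)
    where
    lemma : ∀ a b c d → a + b + (c + d) ≡ a + c + (b + d)
    lemma = solve-∀

  ∑-*ʳ : ∀ (f : X → ℕ) c xs → ∑ xs (λ x → f x * c) ≡ ∑ xs f * c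
  ∑-*ʳ f c []       = refl
  ∑-*ʳ f c (x ∷ xs) rewrite ∑-*ʳ f c xs = sym (ℕ.*-distribʳ-+ c (f x) (∑ xs f))

  ∑-swap : ∀ (f : X → Y → ℕ) xs ys →
    ∑ xs (λ x → ∑ ys (f x)) ≡ ∑ ys (λ y → ∑ xs (λ x → f x y))
  ∑-swap f []       ys = sym (∑-zero ys λ _ → refl)
  ∑-swap f (x ∷ xs) ys rewrite ∑-swap f xs ys = sym (∑-+ (f x) _ ys)

  -- The other terms are selected by an indicator factor and not by a shorter list, so that `⟦⟧-×`
  -- can merge this factor with an indicator being summed.
  ∑-remove : ∀ (_≟_ : (x y : X) → Dec (x ≡ y)) (f : X → ℕ) {xs i} → Unique xs → i ∈ xs →
    ∑ xs f ≡ f i + ∑ xs (λ x → ⟦ ¬? (x ≟ i) ⟧ * f x)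
  ∑-remove _≟_ f {x ∷ xs} {i} (x∉xs ∷ _) (here refl)
    rewrite ⟦⟧-no (¬? (x ≟ x)) (λ x≢x → x≢x refl) =
    cong (f x +_) (∑-cong xs λ {y} y∈xs → sym (trans
      (cong (_* f y) (⟦⟧-yes (¬? (y ≟ x)) (λ y≡x → All.lookup x∉xs y∈xs (sym y≡x))))
      (ℕ.*-identityˡ (f y))))
  ∑-remove _≟_ f {x ∷ xs} {i} (x∉xs ∷ u) (there i∈xs)
    rewrite ⟦⟧-yes (¬? (x ≟ i)) (All.lookup x∉xs i∈xs) | ∑-remove _≟_ f u i∈xs =
    lemma (f x) (f i) _
    where
    lemma : ∀ a b c → a + (b + c) ≡ b + (a + 0 + c)
    lemma = solve-∀

  length-filter : ∀ {P : X → Set} (P? : Decidable P) xs → length (filter P? xs) ≡ ∑ xs (⟦_⟧ ∘ P?)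
  length-filter P? []       = refl
  length-filter P? (x ∷ xs) with does (P? x)
  ... | true  = cong suc (length-filter P? xs)
  ... | false = length-filter P? xs

  -- Sums over sublists

  ∑-sublists-++ : ∀ (f : List X → ℕ) xs ys →
    ∑ (sublists (xs ++ ys)) f ≡ ∑ (sublists xs) (λ q → ∑ (sublists ys) (λ p → f (q ++ p)))
  ∑-sublists-++ f []       ys = sym (ℕ.+-identityʳ _)
  ∑-sublists-++ f (x ∷ xs) ys = begin
    ∑ (map (x ∷_) (sublists (xs ++ ys)) ++ sublists (xs ++ ys)) f
      ≡⟨ ∑-++ f (map (x ∷_) (sublists (xs ++ ys))) _ ⟩
    ∑ (map (x ∷_) (sublists (xs ++ ys))) f + ∑ (sublists (xs ++ ys)) f
      ≡⟨ cong₂ _+_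
           (trans (∑-map f (x ∷_) (sublists (xs ++ ys))) (∑-sublists-++ (f ∘ (x ∷_)) xs ys))
           (∑-sublists-++ f xs ys) ⟩
    ∑ (sublists xs) (h ∘ (x ∷_)) + ∑ (sublists xs) h
      ≡⟨ cong (_+ ∑ (sublists xs) h) (∑-map h (x ∷_) (sublists xs)) ⟨
    ∑ (map (x ∷_) (sublists xs)) h + ∑ (sublists xs) h
      ≡⟨ ∑-++ h (map (x ∷_) (sublists xs)) _ ⟨
    ∑ (map (x ∷_) (sublists xs) ++ sublists xs) h ∎
    where
    h : List _ → ℕ
    h q = ∑ (sublists ys) (λ p → f (q ++ p))

  -- Meant for the squares of one row, which hold at most one rook. The hypothesis passes to
  -- `f ∘ (x ∷_)`, whose values on singletons vanish as well.
  ∑-sublists-≤1 : ∀ (f : List X → ℕ) xs →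
    (∀ {s t} q → s ∈ xs → t ∈ xs → f (s ∷ t ∷ q) ≡ 0) →
    ∑ (sublists xs) f ≡ f [] + ∑ xs (λ s → f (s ∷ []))
  ∑-sublists-≤1 f []       z = refl
  ∑-sublists-≤1 f (x ∷ xs) z = begin
    ∑ (map (x ∷_) (sublists xs) ++ sublists xs) f
      ≡⟨ ∑-++ f (map (x ∷_) (sublists xs)) _ ⟩
    ∑ (map (x ∷_) (sublists xs)) f + ∑ (sublists xs) f
      ≡⟨ cong₂ _+_ (∑-map f (x ∷_) (sublists xs))
           (∑-sublists-≤1 f xs λ q s∈ t∈ → z q (there s∈) (there t∈)) ⟩
    ∑ (sublists xs) (f ∘ (x ∷_)) + (f [] + singles)
      ≡⟨ cong (_+ (f [] + singles)) (∑-sublists-≤1 (f ∘ (x ∷_)) xs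
           λ q s∈ _ → z _ (here refl) (there s∈)) ⟩
    f (x ∷ []) + ∑ xs (λ s → f (x ∷ s ∷ [])) + (f [] + singles)
      ≡⟨ cong (λ a → f (x ∷ []) + a + (f [] + singles))
           (∑-zero xs λ s∈ → z [] (here refl) (there s∈)) ⟩
    f (x ∷ []) + 0 + (f [] + singles)
      ≡⟨ lemma (f (x ∷ [])) (f []) singles ⟩
    f [] + (f (x ∷ []) + singles) ∎
    where
    singles : ℕ
    singles = ∑ xs (λ s → f (s ∷ []))
    lemma : ∀ a b c → a + 0 + (b + c) ≡ b + (a + c)
    lemma = solve-∀

  All-sublists : ∀ {P : X → Set} {xs} → All P xs → All (All P) (sublists xs)
  All-sublists []       = [] ∷ []
  All-sublists (p ∷ ps) = All.++⁺ (All.map⁺ (All.map (p ∷_) (All-sublists ps))) (All-sublists ps)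

  -- Free columns and free rows

  lines : ℕ → List ℕ
  lines n = map suc (downFrom n)

  ∈-lines : ∀ n {i} → i ∈ lines n ⇔ (1 ≤ i × i ≤ n)
  ∈-lines n = mk⇔
    (λ p → case ∈-map⁻ suc p of λ { (_ , q , refl) → s≤s z≤n , ∈-downFrom⁻ q })
    λ { (s≤s _ , i≤n) → ∈-map⁺ suc (∈-downFrom⁺ i≤n) }

  lines-unique : ∀ n → Unique (lines n)
  lines-unique n = Unique.map⁺ ℕ.suc-injective (Unique.downFrom⁺ n)

  ∑-lines-1 : ∀ n → ∑ (lines n) (λ _ → 1) ≡ n
  ∑-lines-1 zero    = refl
  ∑-lines-1 (suc n) = cong suc (∑-lines-1 n)

  FreeCol FreeRow : List Square → ℕ → Set
  FreeCol p i = All (λ t → i ≢ col t) p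
  FreeRow p j = All (λ t → j ≢ row t) p

  freeCol? : ∀ p → Decidable (FreeCol p)
  freeCol? p i = All.all? (λ t → ¬? (i ℕ.≟ col t)) p

  freeRow? : ∀ p → Decidable (FreeRow p)
  freeRow? p j = All.all? (λ t → ¬? (j ℕ.≟ row t)) p

  rookPlacement-∷ : ∀ {s p} →
    RookPlacement (s ∷ p) ⇔ (FreeCol p (col s) × FreeRow p (row s) × RookPlacement p)
  rookPlacement-∷ = mk⇔
    (λ { (a ∷ r) → All.map proj₁ a , All.map proj₂ a , r })
    λ { (c , e , r) → All.zip (c , e) ∷ r }

  -- The lowest square of column i lies in row i, so `i ≤ j` puts `(i , j)` on the board. A free
  -- column with this property can still receive a rook.
  FreeRowAbove : ℕ → List Square → ℕ → Set
  FreeRowAbove n p i = Any (λ j → i ≤ j × FreeRow p j) (lines n)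

  freeRowAbove? : ∀ n p → Decidable (FreeRowAbove n p)
  freeRowAbove? n p i = Any.any? (λ j → (i ℕ.≤? j) ×-dec freeRow? p j) (lines n)

  pending? : ∀ n p i → Dec (FreeCol p i × FreeRowAbove n p i)
  pending? n p i = freeCol? p i ×-dec freeRowAbove? n p i

  optional? : ∀ n p i → Dec (FreeCol p i × ¬ FreeRowAbove n p i)
  optional? n p i = freeCol? p i ×-dec ¬? (freeRowAbove? n p i)

  pending optional : ℕ → List Square → ℕ
  pending  n p = ∑ (lines n) (⟦_⟧ ∘ pending? n p)
  optional n p = ∑ (lines n) (⟦_⟧ ∘ optional? n p)

  Inside : ℕ → Square → Set
  Inside n s = 1 ≤ col s × col s ≤ n × row s ≤ n

  board-inside : ∀ n → All (Inside n) (board n)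
  board-inside n = All.tabulate λ s∈ → case to (∈-board n) s∈ of λ
    { (1≤i , i≤j , j≤n) → 1≤i , ℕ.≤-trans i≤j j≤n , j≤n }

  freeCol-above : ∀ {n p} → All (Inside n) p → FreeCol p (suc n)
  freeCol-above = All.map λ { (_ , c≤n , _) refl → ℕ.1+n≰n c≤n }

  freeRow-above : ∀ {n p} → All (Inside n) p → FreeRow p (suc n)
  freeRow-above = All.map λ { (_ , _ , r≤n) refl → ℕ.1+n≰n r≤n }

  ¬freeRowAbove-suc : ∀ n p → ¬ FreeRowAbove n p (suc n)
  ¬freeRowAbove-suc n p c with j , j∈ , n<j , _ ← find c =
    ℕ.1+n≰n (ℕ.≤-trans n<j (proj₂ (to (∈-lines n) j∈)))

  ∑-freeCol : ∀ n p → ∑ (lines n) (⟦_⟧ ∘ freeCol? p) ≡ pending n p + optional n p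
  ∑-freeCol n p = begin
    ∑ (lines n) (⟦_⟧ ∘ freeCol? p)
      ≡⟨ ∑-cong (lines n) (λ {i} _ → ⟦⟧-partition (freeCol? p i) (freeRowAbove? n p i)) ⟩
    ∑ (lines n) (λ i → ⟦ pending? n p i ⟧ + ⟦ optional? n p i ⟧)
      ≡⟨ ∑-+ (⟦_⟧ ∘ pending? n p) (⟦_⟧ ∘ optional? n p) (lines n) ⟩
    pending n p + optional n p ∎

  -- Each rook occupies a column of its own: the column of the first rook is free for the remaining
  -- ones, so adding it removes exactly one free column.
  freeCol-count : ∀ {n p} → All (Inside n) p → RookPlacement p →
    ∑ (lines n) (⟦_⟧ ∘ freeCol? p) + length p ≡ n
  freeCol-count {n} [] [] = trans (ℕ.+-identityʳ _) (∑-lines-1 n)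
  freeCol-count {n} {s ∷ p} ((1≤i , i≤n , _) ∷ ins) rp
    with free , _ , rp′ ← to rookPlacement-∷ rp = begin
    ∑ (lines n) (⟦_⟧ ∘ freeCol? (s ∷ p)) + suc (length p)
      ≡⟨ cong (_+ suc (length p)) (∑-cong (lines n) λ {c} _ →
           ⟦⟧-× (¬? (c ℕ.≟ col s)) (freeCol? p c)) ⟩
    R + suc (length p)
      ≡⟨ ℕ.+-suc R (length p) ⟩
    1 + R + length p
      ≡⟨ cong (λ a → a + R + length p) (⟦⟧-yes (freeCol? p (col s)) free) ⟨
    ⟦ freeCol? p (col s) ⟧ + R + length p
      ≡⟨ cong (_+ length p) (∑-remove ℕ._≟_ (⟦_⟧ ∘ freeCol? p) (lines-unique n)
           (from (∈-lines n) (1≤i , i≤n))) ⟨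
    ∑ (lines n) (⟦_⟧ ∘ freeCol? p) + length p
      ≡⟨ freeCol-count ins rp′ ⟩
    n ∎
    where
    R : ℕ
    R = ∑ (lines n) (λ c → ⟦ ¬? (c ℕ.≟ col s) ⟧ * ⟦ freeCol? p c ⟧)

  -- Adding one column and one row

  module EmptyTopRow {n p} (ins : All (Inside n) p) where

    freeRowAbove : ∀ {i} → i ∈ lines (suc n) → FreeRowAbove (suc n) p i
    freeRowAbove i∈ = here (proj₂ (to (∈-lines (suc n)) i∈) , freeRow-above ins)

    -- The empty top row is a free row at or above the lowest square of every column, so every free
    -- column becomes pending.
    pending-suc : pending (suc n) p ≡ suc (pending n p + optional n p)
    pending-suc = begin
      pending (suc n) p
        ≡⟨ ∑-cong (lines (suc n)) (λ {i} i∈ → ⟦⟧-cong (pending? (suc n) p i) (freeCol? p i)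
             (mk⇔ proj₁ (_, freeRowAbove i∈))) ⟩
      -- `lines (suc n)` unfolds to `suc n ∷ lines n`; the head is the new column, free because all
      -- rooks lie further left.
      ⟦ freeCol? p (suc n) ⟧ + ∑ (lines n) (⟦_⟧ ∘ freeCol? p)
        ≡⟨ cong₂ _+_ (⟦⟧-yes (freeCol? p (suc n)) (freeCol-above ins)) (∑-freeCol n p) ⟩
      suc (pending n p + optional n p) ∎

    optional-suc : optional (suc n) p ≡ 0
    optional-suc = ∑-zero (lines (suc n)) λ {i} i∈ →
      ⟦⟧-no (optional? (suc n) p i) λ (_ , ¬c) → ¬c (freeRowAbove i∈)

  module _ {n p} (ins : All (Inside n) p) where

    ∑-pending : ∑ (lines (suc n)) (⟦_⟧ ∘ pending? n p) ≡ pending n p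
    ∑-pending = cong (_+ pending n p)
      (⟦⟧-no (pending? n p (suc n)) (¬freeRowAbove-suc n p ∘ proj₂))

    -- Here there are `suc n` columns but still n rows: the new column is free and has no square in
    -- these rows, so it counts as optional.
    ∑-optional : ∑ (lines (suc n)) (⟦_⟧ ∘ optional? n p) ≡ suc (optional n p)
    ∑-optional = cong (_+ optional n p)
      (⟦⟧-yes (optional? n p (suc n)) (freeCol-above ins , ¬freeRowAbove-suc n p))

    module RookInTopRow {i} (i∈ : i ∈ lines (suc n)) where

      -- The rook takes the new row and no old one, so the free rows stay the same.
      freeRowAbove-⇔ : ∀ {c} → FreeRowAbove (suc n) ((i , suc n) ∷ p) c ⇔ FreeRowAbove n p c
      freeRowAbove-⇔ = mk⇔
        (λ { (here (_ , ≢ ∷ _)) → contradiction refl ≢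
           ; (there a) → Any.map (λ { (c≤j , _ ∷ e) → c≤j , e }) a })
        (λ a → case find a of λ { (j , j∈ , c≤j , e) → there (lose j∈
          (c≤j , (λ { refl → ℕ.1+n≰n (proj₂ (to (∈-lines n) j∈)) }) ∷ e)) })

      -- The rook changes the status of no column but i. Stating this additively avoids subtraction.
      pending-remove : pending n p ≡ ⟦ pending? n p i ⟧ + pending (suc n) ((i , suc n) ∷ p)
      pending-remove = begin
        pending n p
          ≡⟨ ∑-pending ⟨
        ∑ (lines (suc n)) (⟦_⟧ ∘ pending? n p)
          ≡⟨ ∑-remove ℕ._≟_ (⟦_⟧ ∘ pending? n p) (lines-unique (suc n)) i∈ ⟩
        ⟦ pending? n p i ⟧ + ∑ (lines (suc n)) (λ c → ⟦ ¬? (c ℕ.≟ i) ⟧ * ⟦ pending? n p c ⟧)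
          ≡⟨ cong (⟦ pending? n p i ⟧ +_) (∑-cong (lines (suc n)) λ {c} _ → trans
               (sym (⟦⟧-× (¬? (c ℕ.≟ i)) (pending? n p c)))
               (⟦⟧-cong (¬? (c ℕ.≟ i) ×-dec pending? n p c) (pending? (suc n) _ c) (mk⇔
                 (λ { (≢ , f , a) → ≢ ∷ f , from freeRowAbove-⇔ a })
                 (λ { (≢ ∷ f , a) → ≢ , f , to freeRowAbove-⇔ a })))) ⟩
        ⟦ pending? n p i ⟧ + pending (suc n) ((i , suc n) ∷ p) ∎

      optional-remove : suc (optional n p) ≡ ⟦ optional? n p i ⟧ + optional (suc n) ((i , suc n) ∷ p)
      optional-remove = begin
        suc (optional n p)
          ≡⟨ ∑-optional ⟨
        ∑ (lines (suc n)) (⟦_⟧ ∘ optional? n p)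
          ≡⟨ ∑-remove ℕ._≟_ (⟦_⟧ ∘ optional? n p) (lines-unique (suc n)) i∈ ⟩
        ⟦ optional? n p i ⟧ + ∑ (lines (suc n)) (λ c → ⟦ ¬? (c ℕ.≟ i) ⟧ * ⟦ optional? n p c ⟧)
          ≡⟨ cong (⟦ optional? n p i ⟧ +_) (∑-cong (lines (suc n)) λ {c} _ → trans
               (sym (⟦⟧-× (¬? (c ℕ.≟ i)) (optional? n p c)))
               (⟦⟧-cong (¬? (c ℕ.≟ i) ×-dec optional? n p c) (optional? (suc n) _ c) (mk⇔
                 (λ { (≢ , f , ¬a) → ≢ ∷ f , ¬a ∘ to freeRowAbove-⇔ })
                 (λ { (≢ ∷ f , ¬a) → ≢ , f , ¬a ∘ from freeRowAbove-⇔ })))) ⟩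
        ⟦ optional? n p i ⟧ + optional (suc n) ((i , suc n) ∷ p) ∎

      -- The new column adds one to the optional ones, and the rook takes one off the kind to which
      -- column i belongs.
      place : ∀ (φ : ℕ → ℕ → ℕ) →
        ⟦ freeCol? p i ⟧ * φ (pending (suc n) ((i , suc n) ∷ p)) (optional (suc n) ((i , suc n) ∷ p))
        ≡ ⟦ pending? n p i ⟧ * φ (pred (pending n p)) (suc (optional n p))
          + ⟦ optional? n p i ⟧ * φ (pending n p) (optional n p)
      place φ with freeCol? p i | freeRowAbove? n p i | pending-remove | optional-remove
      ... | no _  | _     | _ | _ = refl
      ... | yes _ | yes _ | b | o rewrite b | o = sym (ℕ.+-identityʳ _)
      ... | yes _ | no _  | b | o rewrite b | ℕ.suc-injective o = refl

  -- Summing weights over all placements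

  Weight : Set
  Weight = ℕ → ℕ → ℕ

  -- The effect of one more row, dually: step φ b g sums φ over the successors of
  -- the state (b , g).
  step : Weight → Weight
  step φ b g = φ (suc (b + g)) 0 + (b * φ (pred b) (suc g) + suc g * φ b g)

  -- The indicator lets sums range over all sublists of the board, placements or not.
  weight : Weight → ℕ → List Square → ℕ
  weight φ n p = ⟦ rookPlacement? p ⟧ * φ (pending n p) (optional n p)

  weight-yes : ∀ φ n p → RookPlacement p → weight φ n p ≡ φ (pending n p) (optional n p)
  weight-yes φ n p rp = trans
    (cong (_* φ (pending n p) (optional n p)) (⟦⟧-yes (rookPlacement? p) rp))
    (ℕ.*-identityˡ _)

  weight-no : ∀ φ n p → ¬ RookPlacement p → weight φ n p ≡ 0
  weight-no φ n p ¬rp = cong (_* φ (pending n p) (optional n p)) (⟦⟧-no (rookPlacement? p) ¬rp)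

  -- Over a placement p in the lower rows, the top row is empty or holds a rook in a free column;
  -- `place` sorts the latter case by kind of column. If p is no placement, every term is zero.
  weight-suc : ∀ φ {n p} → All (Inside n) p →
    weight φ (suc n) p + ∑ (lines (suc n)) (λ i → weight φ (suc n) ((i , suc n) ∷ p))
    ≡ weight (step φ) n p
  weight-suc φ {n} {p} ins = case rookPlacement? p of λ
    { (no ¬rp) → trans
        (cong₂ _+_ (weight-no φ (suc n) p ¬rp) (∑-zero (lines (suc n)) λ {i} _ →
          weight-no φ (suc n) ((i , suc n) ∷ p) λ { (_ ∷ rp) → ¬rp rp }))
        (sym (weight-no (step φ) n p ¬rp))
    ; (yes rp) → trans (placed rp) (sym (weight-yes (step φ) n p rp))
    }
    where
    b = pending n p
    g = optional n p
    e = φ (suc (b + g)) 0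
    placed : RookPlacement p →
      weight φ (suc n) p + ∑ (lines (suc n)) (λ i → weight φ (suc n) ((i , suc n) ∷ p)) ≡ step φ b g
    placed rp = begin
      weight φ (suc n) p + ∑ (lines (suc n)) (λ i → weight φ (suc n) ((i , suc n) ∷ p))
        ≡⟨ cong₂ _+_
             (trans (weight-yes φ (suc n) p rp)
               (cong₂ φ (EmptyTopRow.pending-suc ins) (EmptyTopRow.optional-suc ins)))
             (∑-cong (lines (suc n)) λ {i} i∈ → trans
               (cong (_* φ (pending (suc n) ((i , suc n) ∷ p)) (optional (suc n) ((i , suc n) ∷ p)))
                 (⟦⟧-cong (rookPlacement? ((i , suc n) ∷ p)) (freeCol? p i) (mk⇔
                   (proj₁ ∘ to rookPlacement-∷)
                   λ f → from rookPlacement-∷ (f , freeRow-above ins , rp))))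
               (RookInTopRow.place ins i∈ φ)) ⟩
      e + ∑ (lines (suc n)) (λ i → ⟦ pending? n p i ⟧ * φ (pred b) (suc g) + ⟦ optional? n p i ⟧ * φ b g)
        ≡⟨ cong (e +_) (∑-+ (λ i → ⟦ pending? n p i ⟧ * φ (pred b) (suc g)) _ (lines (suc n))) ⟩
      e + (∑ (lines (suc n)) (λ i → ⟦ pending? n p i ⟧ * φ (pred b) (suc g))
           + ∑ (lines (suc n)) (λ i → ⟦ optional? n p i ⟧ * φ b g))
        ≡⟨ cong (e +_) (cong₂ _+_
             (trans (∑-*ʳ (⟦_⟧ ∘ pending? n p) _ (lines (suc n)))
               (cong (_* φ (pred b) (suc g)) (∑-pending ins)))
             (trans (∑-*ʳ (⟦_⟧ ∘ optional? n p) _ (lines (suc n)))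
               (cong (_* φ b g) (∑-optional ins)))) ⟩
      step φ b g ∎

  -- Value at (0 , 0), the state of the empty board, after n applications of `step`: the weight is
  -- pulled back instead of the states being pushed forward.
  evolve : Weight → ℕ → ℕ
  evolve φ zero    = φ 0 0
  evolve φ (suc n) = evolve (step φ) n

  ∑-weight : ∀ φ n → ∑ (sublists (board n)) (weight φ n) ≡ evolve φ n
  ∑-weight φ zero    = lemma (φ 0 0)
    where
    lemma : ∀ a → 1 * a + 0 ≡ a
    lemma = solve-∀
  ∑-weight φ (suc n) = begin
    ∑ (sublists (boardRow (suc n) ++ board n)) (weight φ (suc n))
      ≡⟨ ∑-sublists-++ (weight φ (suc n)) (boardRow (suc n)) (board n) ⟩
    ∑ (sublists (boardRow (suc n))) h
      -- Two rooks in the top row attack each other, whatever the lower rows hold.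
      ≡⟨ ∑-sublists-≤1 h (boardRow (suc n)) (λ {s} {t} q s∈ t∈ → ∑-zero (sublists (board n)) λ {p} _ →
           weight-no φ (suc n) (s ∷ t ∷ q ++ p) λ
             { (((_ , r≢) ∷ _) ∷ _) → r≢ (trans (row≡ s∈) (sym (row≡ t∈))) }) ⟩
    h [] + ∑ (boardRow (suc n)) (λ s → h (s ∷ []))
      ≡⟨ cong (h [] +_) (trans (∑-map _ _ (downFrom (suc n))) (sym (∑-map _ suc (downFrom (suc n))))) ⟩
    h [] + ∑ (lines (suc n)) (λ i → h ((i , suc n) ∷ []))
      -- After the exchange the top-row choices are summed for each fixed p, as `weight-suc`
      -- expects.
      ≡⟨ cong (h [] +_) (∑-swap (λ i p → weight φ (suc n) ((i , suc n) ∷ p))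
           (lines (suc n)) (sublists (board n))) ⟩
    h [] + ∑ (sublists (board n)) (λ p → ∑ (lines (suc n)) (λ i → weight φ (suc n) ((i , suc n) ∷ p)))
      ≡⟨ ∑-+ (weight φ (suc n)) _ (sublists (board n)) ⟨
    ∑ (sublists (board n)) (λ p → weight φ (suc n) p
      + ∑ (lines (suc n)) (λ i → weight φ (suc n) ((i , suc n) ∷ p)))
      ≡⟨ ∑-cong-All (All.map (weight-suc φ) (All-sublists (board-inside n))) ⟩
    ∑ (sublists (board n)) (weight (step φ) n)
      ≡⟨ ∑-weight (step φ) n ⟩
    evolve (step φ) n ∎
    where
    h : List Square → ℕ
    h q = ∑ (sublists (board n)) (λ p → weight φ (suc n) (q ++ p))
    row≡ : ∀ {s} → s ∈ boardRow (suc n) → row s ≡ suc n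
    row≡ s∈ = proj₂ (proj₂ (to (∈-boardRow {m = suc n}) s∈))

  -- Maximality and the number of rooks in terms of the state

  δ : ℕ → ℕ → ℕ
  δ m n = ⟦ m ℕ.≟ n ⟧

  δ² : ℕ → ℕ → Weight
  δ² m k b g = δ m b * δ k g

  pending≡0 : ∀ n p →
    (pending n p ≡ 0) ⇔ (∀ {i} → i ∈ lines n → ¬ (FreeCol p i × FreeRowAbove n p i))
  pending≡0 n p = mk⇔
    (λ b≡0 {i} i∈ fc → case trans (sym (⟦⟧-yes (pending? n p i) fc)) (∑-zero⁻ (lines n) b≡0 i∈) of λ ())
    (λ none → ∑-zero (lines n) λ {i} i∈ → ⟦⟧-no (pending? n p i) (none i∈))

  -- A square can be added exactly when its column and its row are both free, so some square can be
  -- added exactly when some column is pending.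
  maximal-⇔ : ∀ {n p} → All (Inside n) p → Maximal n p ⇔ (RookPlacement p × pending n p ≡ 0)
  maximal-⇔ {n} {p} ins = mk⇔
    (λ (rp , mx) → rp , from (pending≡0 n p) λ {i} i∈ (f , c) →
      case find c of λ { (j , j∈ , i≤j , e) →
        All.lookup mx (from (∈-board n) (proj₁ (to (∈-lines n) i∈) , i≤j , proj₂ (to (∈-lines n) j∈)))
          (λ s∈ → All.lookup f s∈ refl)
          (from rookPlacement-∷ (f , e , rp)) })
    (λ (rp , b≡0) → rp , All.tabulate λ {s} s∈ s∉ rp′ →
      let f , e , _ = to rookPlacement-∷ rp′
          1≤i , i≤j , j≤n = to (∈-board n) s∈
      in to (pending≡0 n p) b≡0
           (from (∈-lines n) (1≤i , ℕ.≤-trans i≤j j≤n))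
           (f , lose (from (∈-lines n) (ℕ.≤-trans 1≤i i≤j , j≤n)) (i≤j , e)))

  -- Moving k to the other side gives an equation of natural numbers without truncated subtraction;
  -- for n < k neither equation has a solution.
  length-⇔ : ∀ {l n} k → (ℤ.+ l ≡ ℤ.+ n ℤ.- ℤ.+ k) ⇔ (k + l ≡ n)
  length-⇔ {l} {n} k = mk⇔
    (λ e → ℤ.+-injective (begin
      ℤ.+ k ℤ.+ ℤ.+ l                 ≡⟨ cong (λ a → ℤ.+ k ℤ.+ a) e ⟩
      ℤ.+ k ℤ.+ (ℤ.+ n ℤ.- ℤ.+ k)     ≡⟨ lemma (ℤ.+ k) (ℤ.+ n) ⟩
      ℤ.+ n                           ∎))
    (λ { refl → lemma′ (ℤ.+ k) (ℤ.+ l) })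
    where
    lemma : ∀ a b → a ℤ.+ (b ℤ.- a) ≡ b
    lemma = ℤ.solve-∀
    lemma′ : ∀ a b → b ≡ (a ℤ.+ b) ℤ.- a
    lemma′ = ℤ.solve-∀

  -- With no pending column the free columns are the g optional ones; together with the rooks they
  -- number n, so having n - k rooks means g = k.
  F-weight : ∀ k n → F n (ℤ.+ n ℤ.- ℤ.+ k) ≡ evolve (δ² 0 k) n
  F-weight k n = begin
    length (filter M? (sublists (board n)))
      ≡⟨ length-filter M? (sublists (board n)) ⟩
    ∑ (sublists (board n)) (⟦_⟧ ∘ M?)
      ≡⟨ ∑-cong-All (All.map M-weight (All-sublists (board-inside n))) ⟩
    ∑ (sublists (board n)) (weight (δ² 0 k) n)
      ≡⟨ ∑-weight (δ² 0 k) n ⟩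
    evolve (δ² 0 k) n ∎
    where
    M? : ∀ p → Dec (Maximal n p × ℤ.+ length p ≡ ℤ.+ n ℤ.- ℤ.+ k)
    M? p = maximal? n p ×-dec (ℤ.+ length p ℤ.≟ ℤ.+ n ℤ.- ℤ.+ k)
    module _ {p} (ins : All (Inside n) p) where
      b = pending n p
      g = optional n p
      total : RookPlacement p → b + g + length p ≡ n
      total rp = trans (cong (_+ length p) (sym (∑-freeCol n p))) (freeCol-count ins rp)
      M⇔ : (Maximal n p × ℤ.+ length p ≡ ℤ.+ n ℤ.- ℤ.+ k) ⇔ (RookPlacement p × 0 ≡ b × k ≡ g)
      M⇔ = mk⇔
        (λ (mx , l) → let rp , b≡0 = to (maximal-⇔ ins) mx in
          rp , sym b≡0 , ℕ.+-cancelʳ-≡ (length p) k g (trans (to (length-⇔ k) l)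
            (trans (sym (total rp)) (cong (λ a → a + g + length p) b≡0))))
        (λ (rp , 0≡b , k≡g) → from (maximal-⇔ ins) (rp , sym 0≡b) ,
          from (length-⇔ k) (trans (cong₂ (λ a c → a + c + length p) 0≡b k≡g) (total rp)))
      M-weight : ⟦ M? p ⟧ ≡ weight (δ² 0 k) n p
      M-weight = begin
        ⟦ M? p ⟧
          ≡⟨ ⟦⟧-cong (M? p) (rookPlacement? p ×-dec (0 ℕ.≟ b ×-dec k ℕ.≟ g)) M⇔ ⟩
        ⟦ rookPlacement? p ×-dec (0 ℕ.≟ b ×-dec k ℕ.≟ g) ⟧
          ≡⟨ ⟦⟧-× (rookPlacement? p) (0 ℕ.≟ b ×-dec k ℕ.≟ g) ⟩
        ⟦ rookPlacement? p ⟧ * ⟦ 0 ℕ.≟ b ×-dec k ℕ.≟ g ⟧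
          ≡⟨ cong (⟦ rookPlacement? p ⟧ *_) (⟦⟧-× (0 ℕ.≟ b) (k ℕ.≟ g)) ⟩
        weight (δ² 0 k) n p ∎

  -- Linear recurrences in the number of rows

  evolve-cong : ∀ {φ ψ} → (∀ b g → φ b g ≡ ψ b g) → ∀ n → evolve φ n ≡ evolve ψ n
  evolve-cong e zero    = e 0 0
  evolve-cong e (suc n) = evolve-cong (λ b g → cong₂ _+_ (e _ 0) (cong₂ _+_
    (cong (b *_) (e (pred b) (suc g))) (cong (suc g *_) (e b g)))) n

  evolve-combination : ∀ c d φ ψ n →
    evolve (λ b g → c * φ b g + d * ψ b g) n ≡ c * evolve φ n + d * evolve ψ n
  evolve-combination c d φ ψ zero    = refl
  evolve-combination c d φ ψ (suc n) = trans
    (evolve-cong (λ b g → lemma c d b (suc g) (φ _ 0) (ψ _ 0) (φ (pred b) _) (ψ (pred b) _) (φ b g) (ψ b g)) n)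
    (evolve-combination c d (step φ) (step ψ) n)
    where
    lemma : ∀ c d b g u v w x y z →
      c * u + d * v + (b * (c * w + d * x) + g * (c * y + d * z))
      ≡ c * (u + (b * w + g * y)) + d * (v + (b * x + g * z))
    lemma = solve-∀

  -- `evolve φ (suc n)` unfolds to `evolve (step φ) n`, and `step` is linear, so an identity of
  -- weights becomes a recurrence in n.
  evolve-recurrence : ∀ c d φ φ′ φ″ → (∀ b g → step φ b g ≡ c * φ′ b g + d * φ″ b g) →
    ∀ n → evolve φ (suc n) ≡ c * evolve φ′ n + d * evolve φ″ n
  evolve-recurrence c d φ φ′ φ″ e n = trans (evolve-cong e n) (evolve-combination c d φ′ φ″ n)

  -- Fixes only the total of free columns, so that all placements with n - r rooks are counted,
  -- maximal or not; `evolve (α r) n` is the Stirling number of the second kind S(n + 1, r + 1).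
  α : ℕ → Weight
  α r b g = δ r (b + g)

  -- Trades a coefficient that depends on the state for a constant one; off the diagonal both sides
  -- vanish.
  δ-* : ∀ m n → n * δ m n ≡ m * δ m n
  δ-* m n = case m ℕ.≟ n of λ
    { (yes refl) → refl
    ; (no m≢n)   → let z = ⟦⟧-no (m ℕ.≟ n) m≢n in
        trans (cong (n *_) z) (trans (ℕ.*-zeroʳ n) (sym (trans (cong (m *_) z) (ℕ.*-zeroʳ m))))
    }

  -- At b = 0, where `pred` truncates, the factor b is zero.
  pred-δ : ∀ m b → b * δ m (pred b) ≡ suc m * δ (suc m) b
  pred-δ m zero    = sym (ℕ.*-zeroʳ (suc m))
  pred-δ m (suc b) = δ-* (suc m) (suc b)

  -- A rook in the new row has b + g + 1 free columns to choose from and leaves the total of free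
  -- columns unchanged; an empty row raises it by one.
  step-α : ∀ r b g → step (α r) b g ≡ δ r (suc (b + g)) + suc r * α r b g
  step-α r b g = cong₂ _+_ (cong (δ r) (ℕ.+-identityʳ _)) (begin
    b * δ r (pred b + suc g) + suc g * δ r (b + g)
      ≡⟨ cong (_+ suc g * δ r (b + g)) (shift b) ⟩
    b * δ r (b + g) + suc g * δ r (b + g)
      ≡⟨ lemma b g (δ r (b + g)) ⟩
    δ r (b + g) + (b + g) * δ r (b + g)
      ≡⟨ cong (δ r (b + g) +_) (δ-* r (b + g)) ⟩
    suc r * δ r (b + g) ∎)
    where
    shift : ∀ b → b * δ r (pred b + suc g) ≡ b * δ r (b + g)
    shift zero    = refl
    shift (suc b) = cong (λ a → suc b * δ r a) (ℕ.+-suc b g)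
    lemma : ∀ b g d → b * d + suc g * d ≡ d + (b + g) * d
    lemma = solve-∀

  evolve-α-zero : ∀ n → evolve (α 0) (suc n) ≡ 1 * evolve (α 0) n + 0
  evolve-α-zero n = evolve-recurrence 1 0 (α 0) (α 0) (α 0)
    (λ b g → trans (step-α 0 b g) (lemma (α 0 b g))) n
    where
    lemma : ∀ a → 0 + 1 * a ≡ 1 * a + 0 * a
    lemma = solve-∀

  evolve-α-suc : ∀ r n →
    evolve (α (suc r)) (suc n) ≡ suc (suc r) * evolve (α (suc r)) n + evolve (α r) n
  evolve-α-suc r n = trans
    (evolve-recurrence (suc (suc r)) 1 (α (suc r)) (α (suc r)) (α r)
      (λ b g → trans (step-α (suc r) b g) (lemma (α r b g) (suc (suc r) * α (suc r) b g))) n)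
    (cong (suc (suc r) * evolve (α (suc r)) n +_) (ℕ.*-identityˡ _))
    where
    lemma : ∀ a b → a + b ≡ b + 1 * a
    lemma = solve-∀

  evolve-δ²-zero-zero : ∀ n → evolve (δ² 0 0) (suc n) ≡ 1 * evolve (δ² 0 0) n + 0
  evolve-δ²-zero-zero = evolve-recurrence 1 0 (δ² 0 0) (δ² 0 0) (δ² 0 0) λ b g → begin
    b * (δ 0 (pred b) * 0) + suc g * (δ 0 b * δ 0 g)
      ≡⟨ lemma b g (δ 0 (pred b)) (δ 0 b) (δ 0 g) ⟩
    δ 0 b * (δ 0 g + g * δ 0 g)
      ≡⟨ cong (λ a → δ 0 b * (δ 0 g + a)) (δ-* 0 g) ⟩
    δ 0 b * (δ 0 g + 0)
      ≡⟨ lemma′ (δ 0 b) (δ 0 g) ⟩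
    1 * δ² 0 0 b g + 0 * δ² 0 0 b g ∎
    where
    lemma : ∀ b g c d e → b * (c * 0) + suc g * (d * e) ≡ d * (e + g * e)
    lemma = solve-∀
    lemma′ : ∀ d e → d * (e + 0) ≡ 1 * (d * e) + 0 * (d * e)
    lemma′ = solve-∀

  -- A rook in a pending column would leave an optional one. There remain an empty top row over any
  -- placement with m free columns, and a rook in the new column.
  evolve-δ²-suc-zero : ∀ m n →
    evolve (δ² (suc m) 0) (suc n) ≡ 1 * evolve (δ² (suc m) 0) n + evolve (α m) n
  evolve-δ²-suc-zero m n = trans
    (evolve-recurrence 1 1 (δ² (suc m) 0) (δ² (suc m) 0) (α m) (λ b g → begin
      δ m (b + g) * 1 + (b * (δ (suc m) (pred b) * 0) + suc g * (δ (suc m) b * δ 0 g))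
        ≡⟨ lemma b g (δ (suc m) (pred b)) (δ (suc m) b) (δ 0 g) (δ m (b + g)) ⟩
      δ m (b + g) + δ (suc m) b * (δ 0 g + g * δ 0 g)
        ≡⟨ cong (λ a → δ m (b + g) + δ (suc m) b * (δ 0 g + a)) (δ-* 0 g) ⟩
      δ m (b + g) + δ (suc m) b * (δ 0 g + 0)
        ≡⟨ lemma′ (δ (suc m) b) (δ 0 g) (δ m (b + g)) ⟩
      1 * δ² (suc m) 0 b g + 1 * α m b g ∎) n)
    (cong (1 * evolve (δ² (suc m) 0) n +_) (ℕ.*-identityˡ _))
    where
    lemma : ∀ b g c d e a → a * 1 + (b * (c * 0) + suc g * (d * e)) ≡ a + d * (e + g * e)
    lemma = solve-∀
    lemma′ : ∀ d e a → a + d * (e + 0) ≡ 1 * (d * e) + 1 * a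
    lemma′ = solve-∀

  -- An optional column rules out an empty top row. The top rook stands in one of k + 2 optional
  -- columns, coming from the same state, or in one of m + 1 pending columns, coming from (m + 1 ,
  -- k).
  evolve-δ²-suc : ∀ m k n →
    evolve (δ² m (suc k)) (suc n) ≡ suc (suc k) * evolve (δ² m (suc k)) n + suc m * evolve (δ² (suc m) k) n
  evolve-δ²-suc m k = evolve-recurrence (suc (suc k)) (suc m)
    (δ² m (suc k)) (δ² m (suc k)) (δ² (suc m) k) λ b g → begin
    δ m (suc (b + g)) * 0 + (b * (δ m (pred b) * δ k g) + suc g * (δ m b * δ (suc k) g))
      ≡⟨ lemma (δ m (suc (b + g))) b g (δ m (pred b)) (δ k g) (δ m b) (δ (suc k) g) ⟩
    δ m b * (δ (suc k) g + g * δ (suc k) g) + b * δ m (pred b) * δ k g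
      ≡⟨ cong₂ (λ u v → δ m b * (δ (suc k) g + u) + v * δ k g) (δ-* (suc k) g) (pred-δ m b) ⟩
    δ m b * (suc (suc k) * δ (suc k) g) + suc m * δ (suc m) b * δ k g
      ≡⟨ lemma′ (suc (suc k)) (suc m) (δ m b) (δ (suc k) g) (δ (suc m) b) (δ k g) ⟩
    suc (suc k) * δ² m (suc k) b g + suc m * δ² (suc m) k b g ∎
    where
    lemma : ∀ a b g c d e f →
      a * 0 + (b * (c * d) + suc g * (e * f)) ≡ e * (f + g * f) + b * c * d
    lemma = solve-∀
    lemma′ : ∀ k m a b c d → a * (k * b) + m * c * d ≡ k * (a * b) + m * (c * d)
    lemma′ = solve-∀

-- The multiplicative monoid of formal power series

open import Defs
open import Data.Integer using (+_; 0ℤ; 1ℤ)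
open import Data.Integer.Tactic.RingSolver using (solve-∀)
open RookCount using
  ( evolve; α; δ²; F-weight; evolve-α-zero; evolve-α-suc
  ; evolve-δ²-zero-zero; evolve-δ²-suc-zero; evolve-δ²-suc )

-- `(f * g) (suc n)` unfolds to `f 0 ℤ.* g (suc n) ℤ.+ (tail f * g) n`, which drives the inductions
-- on coefficients below.
tail : Series → Series
tail f n = f (suc n)

*-cong : ∀ {f f′ g g′} → f ≈ f′ → g ≈ g′ → f * g ≈ f′ * g′
*-cong p q zero = cong₂ (λ a b → a ℤ.* b ℤ.+ 0ℤ) (p 0) (q 0)
*-cong {f} {f′} p q (suc n) = cong₂ ℤ._+_ (cong₂ ℤ._*_ (p 0) (q (suc n)))
  (*-cong {tail f} {tail f′} (p ∘ suc) q n)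

*-distribʳ : ∀ f g h n → ((λ i → f i ℤ.+ g i) * h) n ≡ (f * h) n ℤ.+ (g * h) n
*-distribʳ f g h zero = lemma (f 0) (g 0) (h 0)
  where
  lemma : ∀ a b c → (a ℤ.+ b) ℤ.* c ℤ.+ 0ℤ ≡ (a ℤ.* c ℤ.+ 0ℤ) ℤ.+ (b ℤ.* c ℤ.+ 0ℤ)
  lemma = solve-∀
*-distribʳ f g h (suc n)
  rewrite *-distribʳ (tail f) (tail g) h n =
  lemma (f 0) (g 0) (h (suc n)) ((tail f * h) n) ((tail g * h) n)
  where
  lemma : ∀ a b c s t → (a ℤ.+ b) ℤ.* c ℤ.+ (s ℤ.+ t) ≡ (a ℤ.* c ℤ.+ s) ℤ.+ (b ℤ.* c ℤ.+ t)
  lemma = solve-∀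

*-scaleˡ : ∀ c f g n → ((λ i → c ℤ.* f i) * g) n ≡ c ℤ.* (f * g) n
*-scaleˡ c f g zero = lemma c (f 0) (g 0)
  where
  lemma : ∀ c a b → (c ℤ.* a) ℤ.* b ℤ.+ 0ℤ ≡ c ℤ.* (a ℤ.* b ℤ.+ 0ℤ)
  lemma = solve-∀
*-scaleˡ c f g (suc n)
  rewrite *-scaleˡ c (tail f) g n = lemma c (f 0) (g (suc n)) ((tail f * g) n)
  where
  lemma : ∀ c a b s → (c ℤ.* a) ℤ.* b ℤ.+ c ℤ.* s ≡ c ℤ.* (a ℤ.* b ℤ.+ s)
  lemma = solve-∀

*-assoc : ∀ f g h → (f * g) * h ≈ f * (g * h)
*-assoc f g h zero = lemma (f 0) (g 0) (h 0)
  where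
  lemma : ∀ a b c → (a ℤ.* b ℤ.+ 0ℤ) ℤ.* c ℤ.+ 0ℤ ≡ a ℤ.* (b ℤ.* c ℤ.+ 0ℤ) ℤ.+ 0ℤ
  lemma = solve-∀
*-assoc f g h (suc n)
  -- `tail (f * g)` is the sum of `tail g` scaled by `f 0` and `tail f * g`.
  rewrite *-distribʳ (λ i → f 0 ℤ.* tail g i) (tail f * g) h n
        | *-scaleˡ (f 0) (tail g) h n
        | *-assoc (tail f) g h n =
  lemma (f 0) (g 0) (h (suc n)) ((tail g * h) n) ((tail f * (g * h)) n)
  where
  lemma : ∀ a b c s t →
    (a ℤ.* b ℤ.+ 0ℤ) ℤ.* c ℤ.+ (a ℤ.* s ℤ.+ t) ≡ a ℤ.* (b ℤ.* c ℤ.+ s) ℤ.+ t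
  lemma = solve-∀

-- The product unfolds at the head of its left factor; peeling the right factor as well makes
-- commutativity an induction.
*-sucʳ : ∀ f g n → (f * g) (suc n) ≡ f (suc n) ℤ.* g 0 ℤ.+ (f * tail g) n
*-sucʳ f g zero = lemma (f 0) (f 1) (g 0) (g 1)
  where
  lemma : ∀ a b c d → a ℤ.* d ℤ.+ (b ℤ.* c ℤ.+ 0ℤ) ≡ b ℤ.* c ℤ.+ (a ℤ.* d ℤ.+ 0ℤ)
  lemma = solve-∀
*-sucʳ f g (suc n) rewrite *-sucʳ (tail f) g n =
  lemma (f 0 ℤ.* g (suc (suc n))) (f (suc (suc n)) ℤ.* g 0) ((tail f * tail g) n)
  where
  lemma : ∀ a b s → a ℤ.+ (b ℤ.+ s) ≡ b ℤ.+ (a ℤ.+ s)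
  lemma = solve-∀

*-comm : ∀ f g → f * g ≈ g * f
*-comm f g zero = cong (ℤ._+ 0ℤ) (ℤ.*-comm (f 0) (g 0))
*-comm f g (suc n) rewrite *-sucʳ g f n =
  cong₂ ℤ._+_ (ℤ.*-comm (f 0) (g (suc n))) (*-comm (tail f) g n)

*-congˡ : ∀ f {g g′} → g ≈ g′ → f * g ≈ f * g′
*-congˡ f {g} {g′} = *-cong {f} {f} {g} {g′} (λ _ → refl)

*-congʳ : ∀ h {f f′} → f ≈ f′ → f * h ≈ f′ * h
*-congʳ h {f} {f′} p = *-cong {f} {f′} {h} {h} p (λ _ → refl)

zero-* : ∀ f n → ((λ _ → 0ℤ) * f) n ≡ 0ℤ
zero-* f zero    = refl
zero-* f (suc n) = trans (ℤ.+-identityˡ _) (zero-* f n)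

constant-* : ∀ c f n → (constant c * f) n ≡ c ℤ.* f n
constant-* c f zero    = ℤ.+-identityʳ _
constant-* c f (suc n) = trans (cong (λ a → c ℤ.* f (suc n) ℤ.+ a) (zero-* f n)) (ℤ.+-identityʳ _)

*-identityˡ : ∀ f → 𝟙 * f ≈ f
*-identityˡ f n = trans (constant-* 1ℤ f n) (ℤ.*-identityˡ (f n))

*-identityʳ : ∀ f → f * 𝟙 ≈ f
*-identityʳ f n = trans (*-comm f 𝟙 n) (*-identityˡ f n)

*-commutativeMonoid : CommutativeMonoid _ _
*-commutativeMonoid = record
  { Carrier = Series
  ; _≈_ = _≈_
  ; _∙_ = _*_
  ; ε = 𝟙
  ; isCommutativeMonoid = record
    { isMonoid = record
      { isSemigroup = record
        { isMagma = record
          { isEquivalence = record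
            { refl  = λ _ → refl
            ; sym   = λ p n → sym (p n)
            ; trans = λ p q n → trans (p n) (q n)
            }
          ; ∙-cong = λ {f} {f′} {g} {g′} → *-cong {f} {f′} {g} {g′}
          }
        ; assoc = *-assoc
        }
      ; identity = *-identityˡ , *-identityʳ
      }
    ; comm = *-comm
    }
  }

open import Algebra.Solver.CommutativeMonoid *-commutativeMonoid
  using (id; _⊕_; _⊜_) renaming (solve to *-solve)
module ≈-Reasoning = SetoidReasoning (CommutativeMonoid.setoid *-commutativeMonoid)

-- Reduces the quotient in the theorem to a product identity, the form in which the closed forms
-- below are proved.
≈-/ : ∀ {f g h} → h 0 ≡ 1ℤ → f * h ≈ g → f ≈ g / h
≈-/ {f} {g} {h} h₀≡1 p = begin
  f               ≈⟨ *-identityʳ f ⟨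
  f * 𝟙           ≈⟨ *-congˡ f (*-inverse h h₀≡1) ⟨
  f * (h * h ⁻¹)  ≈⟨ *-assoc f h (h ⁻¹) ⟨
  (f * h) * h ⁻¹  ≈⟨ *-congʳ (h ⁻¹) p ⟩
  g / h           ∎
  where open ≈-Reasoning

-- Linear factors and first-order recurrences

linear : ℕ → Series
linear c = 𝟙 - constant (+ c) * x

x-*-suc : ∀ f n → (x * f) (suc n) ≡ f n
x-*-suc f n = trans (ℤ.+-identityˡ _) (trans (*-congʳ f tail-x n) (*-identityˡ f n))
  where
  tail-x : tail x ≈ 𝟙
  tail-x zero    = refl
  tail-x (suc _) = refl

linear-* : ∀ c f n → (f * linear c) (suc n) ≡ f (suc n) ℤ.- + c ℤ.* f n
linear-* c f n = begin
  (f * linear c) (suc n)  ≡⟨ *-comm f (linear c) (suc n) ⟩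
  (linear c * f) (suc n)  ≡⟨ cong₂ ℤ._+_ (cong (ℤ._* f (suc n)) (linear-const≡1 (+ c)))
                               (*-congʳ f tail-linear n) ⟩
  1ℤ ℤ.* f (suc n) ℤ.+ (constant (ℤ.- + c) * f) n
    ≡⟨ cong (λ a → 1ℤ ℤ.* f (suc n) ℤ.+ a) (constant-* (ℤ.- + c) f n) ⟩
  1ℤ ℤ.* f (suc n) ℤ.+ (ℤ.- + c) ℤ.* f n  ≡⟨ lemma (+ c) (f n) (f (suc n)) ⟩
  f (suc n) ℤ.- + c ℤ.* f n ∎
  where
  open ≡-Reasoning
  lemma : ∀ c a b → 1ℤ ℤ.* b ℤ.+ (ℤ.- c) ℤ.* a ≡ b ℤ.- c ℤ.* a
  lemma = solve-∀
  tail-linear : tail (linear c) ≈ constant (ℤ.- + c)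
  tail-linear zero    rewrite constant-* (+ c) x 1 =
    trans (ℤ.+-identityˡ _) (cong ℤ.-_ (ℤ.*-identityʳ (+ c)))
  tail-linear (suc n) rewrite constant-* (+ c) x (suc (suc n)) | ℤ.*-zeroʳ (+ c) = refl

linear-recurrence : ∀ c f g → f 0 ≡ g 0 →
  (∀ n → f (suc n) ≡ + c ℤ.* f n ℤ.+ g (suc n)) → f * linear c ≈ g
linear-recurrence c f g p q zero
  rewrite linear-const≡1 (+ c) | p = trans (ℤ.+-identityʳ _) (ℤ.*-identityʳ (g 0))
linear-recurrence c f g p q (suc n) rewrite linear-* c f n | q n =
  lemma (+ c ℤ.* f n) (g (suc n))
  where
  lemma : ∀ a b → (a ℤ.+ b) ℤ.- a ≡ b
  lemma = solve-∀

constant-*-constant : ∀ a b → constant (+ a) * constant (+ b) ≈ constant (+ (a ℕ.* b))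
constant-*-constant a b n = trans (constant-* (+ a) (constant (+ b)) n) (lemma n)
  where
  lemma : ∀ n → + a ℤ.* constant (+ b) n ≡ constant (+ (a ℕ.* b)) n
  lemma zero    = sym (ℤ.pos-* a b)
  lemma (suc n) = ℤ.*-zeroʳ (+ a)

^-+ : ∀ f m n → f ^ (m ℕ.+ n) ≈ f ^ m * f ^ n
^-+ f zero    n i = sym (*-identityˡ (f ^ n) i)
^-+ f (suc m) n = begin
  f * f ^ (m ℕ.+ n)    ≈⟨ *-congˡ f (^-+ f m n) ⟩
  f * (f ^ m * f ^ n)  ≈⟨ *-assoc f (f ^ m) (f ^ n) ⟨
  f ^ suc m * f ^ n    ∎
  where open ≈-Reasoning

-- Generating series and their closed forms

A : ℕ → Series
A r n = + evolve (α r) n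

-- For k ≥ 1 this counts the placements with k free rows, the top row among them.
B : ℕ → Series
B zero    = 𝟙
B (suc r) = x * A r

-- By `F-weight` the series of the theorem is `N 0 k`; positive m enter because `N-suc` trades an
-- optional column for a pending one.
N : ℕ → ℕ → Series
N m k n = + evolve (δ² m k) n

ℕ-recurrence⇒ℤ : ∀ {a} c b d → a ≡ c ℕ.* b ℕ.+ d → + a ≡ + c ℤ.* + b ℤ.+ + d
ℕ-recurrence⇒ℤ c b d p = trans (cong +_ p) (cong (λ a → a ℤ.+ + d) (ℤ.pos-* c b))

A-zero : A 0 * linear 1 ≈ 𝟙
A-zero = linear-recurrence 1 (A 0) 𝟙 refl λ n →
  ℕ-recurrence⇒ℤ 1 (evolve (α 0) n) 0 (evolve-α-zero n)

A-suc : ∀ r → A (suc r) * linear (suc (suc r)) ≈ x * A r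
A-suc r = linear-recurrence (suc (suc r)) (A (suc r)) (x * A r) refl λ n → trans
  (ℕ-recurrence⇒ℤ (suc (suc r)) (evolve (α (suc r)) n) (evolve (α r) n) (evolve-α-suc r n))
  (cong (λ a → + suc (suc r) ℤ.* A (suc r) n ℤ.+ a) (sym (x-*-suc (A r) n)))

N-zero : ∀ m → N m 0 * linear 1 ≈ B m
N-zero zero    = linear-recurrence 1 (N 0 0) 𝟙 refl λ n →
  ℕ-recurrence⇒ℤ 1 (evolve (δ² 0 0) n) 0 (evolve-δ²-zero-zero n)
N-zero (suc m) = linear-recurrence 1 (N (suc m) 0) (x * A m) refl λ n → trans
  (ℕ-recurrence⇒ℤ 1 (evolve (δ² (suc m) 0) n) (evolve (α m) n) (evolve-δ²-suc-zero m n))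
  (cong (λ a → 1ℤ ℤ.* N (suc m) 0 n ℤ.+ a) (sym (x-*-suc (A m) n)))

N-suc : ∀ m k →
  N m (suc k) * linear (suc (suc k)) ≈ constant (+ suc m) * (x * N (suc m) k)
N-suc m k = linear-recurrence (suc (suc k)) (N m (suc k)) (constant (+ suc m) * (x * N (suc m) k))
  -- At n = 0 the count is `δ m 0` times `δ (suc k) 0`, and the second factor is zero.
  (trans (cong +_ (ℕ.*-zeroʳ (evolve (λ b _ → RookCount.δ m b) 0)))
    (sym (trans (constant-* (+ suc m) (x * N (suc m) k) 0) (ℤ.*-zeroʳ (+ suc m)))))
  λ n → trans (ℕ-recurrence⇒ℤ (suc (suc k)) (evolve (δ² m (suc k)) n) (suc m ℕ.* evolve (δ² (suc m) k) n)
      (evolve-δ²-suc m k n))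
    (cong (λ a → + suc (suc k) ℤ.* N m (suc k) n ℤ.+ a) (begin
      + (suc m ℕ.* evolve (δ² (suc m) k) n)  ≡⟨ ℤ.pos-* (suc m) _ ⟩
      + suc m ℤ.* N (suc m) k n              ≡⟨ cong (λ a → + suc m ℤ.* a) (x-*-suc (N (suc m) k) n) ⟨
      + suc m ℤ.* (x * N (suc m) k) (suc n)  ≡⟨ constant-* (+ suc m) (x * N (suc m) k) (suc n) ⟨
      (constant (+ suc m) * (x * N (suc m) k)) (suc n)  ∎))
  where open ≡-Reasoning

P : ℕ → Series
P k = ∏ k linear

open ≈-Reasoning

-- Each linear factor lowers r by one through `A-suc` at the cost of a factor `x`; this is the
-- classical generating function of the Stirling numbers.
A-closed : ∀ r → A r * P (suc r) ≈ x ^ r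
A-closed zero = begin
  A 0 * (𝟙 * linear 1)  ≈⟨ *-congˡ (A 0) (*-identityˡ (linear 1)) ⟩
  A 0 * linear 1        ≈⟨ A-zero ⟩
  𝟙                     ∎
A-closed (suc r) = begin
  A (suc r) * (P (suc r) * linear (suc (suc r)))
    ≈⟨ *-solve 3 (λ a p l → (a ⊕ (p ⊕ l)) ⊜ ((a ⊕ l) ⊕ p)) (λ _ → refl)
         (A (suc r)) (P (suc r)) (linear (suc (suc r))) ⟩
  (A (suc r) * linear (suc (suc r))) * P (suc r)
    ≈⟨ *-congʳ (P (suc r)) (A-suc r) ⟩
  (x * A r) * P (suc r)  ≈⟨ *-assoc x (A r) (P (suc r)) ⟩
  x * (A r * P (suc r))  ≈⟨ *-congˡ x (A-closed r) ⟩
  x * x ^ r              ∎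

B-closed : ∀ k → B k * P k ≈ x ^ k
B-closed zero = *-identityʳ 𝟙
B-closed (suc r) = begin
  (x * A r) * P (suc r)  ≈⟨ *-assoc x (A r) (P (suc r)) ⟩
  x * (A r * P (suc r))  ≈⟨ *-congˡ x (A-closed r) ⟩
  x * x ^ r              ∎

-- Scaling by m ! replaces the rising factorial (m + 1) ⋯ (m + g) by (m + g) !.
N-closed : ∀ g m → (constant (+ (m !)) * N m g) * P (suc g)
                   ≈ (constant (+ ((m ℕ.+ g) !)) * x ^ g) * B (m ℕ.+ g)
N-closed zero m rewrite ℕ.+-identityʳ m = begin
  (C * N m 0) * (𝟙 * linear 1)
    ≈⟨ *-solve 3 (λ c n l → ((c ⊕ n) ⊕ (id ⊕ l)) ⊜ ((c ⊕ id) ⊕ (n ⊕ l))) (λ _ → refl)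
         C (N m 0) (linear 1) ⟩
  (C * 𝟙) * (N m 0 * linear 1)  ≈⟨ *-congˡ (C * 𝟙) (N-zero m) ⟩
  (C * 𝟙) * B m                 ∎
  where C = constant (+ (m !))
N-closed (suc g) m rewrite ℕ.+-suc m g = begin
  (C * N m (suc g)) * (P (suc g) * L)
    ≈⟨ *-solve 4 (λ c n p l → ((c ⊕ n) ⊕ (p ⊕ l)) ⊜ (c ⊕ ((n ⊕ l) ⊕ p))) (λ _ → refl)
         C (N m (suc g)) (P (suc g)) L ⟩
  C * ((N m (suc g) * L) * P (suc g))
    ≈⟨ *-congˡ C (*-congʳ (P (suc g)) (N-suc m g)) ⟩
  C * ((constant (+ suc m) * (x * N (suc m) g)) * P (suc g))
    ≈⟨ *-solve 5 (λ c d y n p → (c ⊕ ((d ⊕ (y ⊕ n)) ⊕ p)) ⊜ (y ⊕ (((d ⊕ c) ⊕ n) ⊕ p)))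
         (λ _ → refl) C (constant (+ suc m)) x (N (suc m) g) (P (suc g)) ⟩
  x * (((constant (+ suc m) * C) * N (suc m) g) * P (suc g))
    ≈⟨ *-congˡ x (*-congʳ (P (suc g)) (*-congʳ (N (suc m) g)
         (constant-*-constant (suc m) (m !)))) ⟩
  x * ((constant (+ (suc m !)) * N (suc m) g) * P (suc g))
    ≈⟨ *-congˡ x (N-closed g (suc m)) ⟩
  x * ((D * x ^ g) * B (suc (m ℕ.+ g)))
    ≈⟨ *-solve 4 (λ y d z b → (y ⊕ ((d ⊕ z) ⊕ b)) ⊜ ((d ⊕ (y ⊕ z)) ⊕ b)) (λ _ → refl)
         x D (x ^ g) (B (suc (m ℕ.+ g))) ⟩
  (D * (x * x ^ g)) * B (suc (m ℕ.+ g))  ∎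
  where
  C = constant (+ (m !))
  D = constant (+ (suc (m ℕ.+ g) !))
  L = linear (suc (suc g))

-- Two descents produce the square: from (0 , k) to (k , 0) by `N-closed`, which uses up `P k` and
-- `linear (suc k)`, then `B-closed`, which uses up the second `P k`. Each yields a factor `x ^ k`.
N₀-closed : ∀ k → N 0 k * (P k ^ 2 * linear (suc k)) ≈ constant (+ (k !)) * x ^ (2 ℕ.* k)
N₀-closed k = begin
  N 0 k * ((P k * (P k * 𝟙)) * linear (suc k))
    -- The inserted unit is `constant (+ (0 !))`, which `N-closed` at m = 0 expects.
    ≈⟨ *-solve 3 (λ n p l → (n ⊕ ((p ⊕ (p ⊕ id)) ⊕ l)) ⊜ (((id ⊕ n) ⊕ (p ⊕ l)) ⊕ p))
         (λ _ → refl) (N 0 k) (P k) (linear (suc k)) ⟩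
  ((𝟙 * N 0 k) * (P k * linear (suc k))) * P k
    ≈⟨ *-congʳ (P k) (N-closed k 0) ⟩
  ((C * x ^ k) * B k) * P k
    ≈⟨ *-assoc (C * x ^ k) (B k) (P k) ⟩
  (C * x ^ k) * (B k * P k)
    ≈⟨ *-congˡ (C * x ^ k) (B-closed k) ⟩
  (C * x ^ k) * x ^ k
    ≈⟨ *-solve 2 (λ c y → ((c ⊕ y) ⊕ y) ⊜ (c ⊕ (y ⊕ (y ⊕ id)))) (λ _ → refl) C (x ^ k) ⟩
  C * (x ^ k * (x ^ k * 𝟙))
    -- `2 ℕ.* k` unfolds to `k ℕ.+ (k ℕ.+ 0)`, so the exponents are merged in two stages, starting
    -- from `x ^ 0`, which is `𝟙`.
    ≈⟨ *-congˡ C (*-congˡ (x ^ k) (^-+ x k 0)) ⟨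
  C * (x ^ k * x ^ (k ℕ.+ 0))
    ≈⟨ *-congˡ C (^-+ x k (k ℕ.+ 0)) ⟨
  C * x ^ (2 ℕ.* k)  ∎
  where C = constant (+ (k !))

corollary4p7 : (k : ℕ) →
    (λ n → + F n (+ n ℤ.- + k))
    ≈ (constant (+ (k !)) * x ^ (2 ℕ.* k))
    / ((∏[1≤ i ≤ k ] (𝟙 - constant (+ i) * x)) ^ 2
    * (𝟙 - constant (+ suc k) * x))
corollary4p7 k n = trans (cong +_ (F-weight k n))
  (≈-/ {N 0 k} (denominator-const≡1 k) (N₀-closed k) n)
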